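{- For any prime $p$ we have $$\sum_{k=1}^{p-1}\frac{2^k}{k}\binom{3k}{k}\equiv 0\pmod p.$$
   Context: Congruences modulo $p$ between rational numbers whose denominators are prime to $p$ are understood in the ring of rationals with denominator prime to $p$ (i.e. $a\equiv b \pmod p$ means that $a-b$ is $p$ times such a rational). -}

module Defs where

open import Algebra.Definitions.RawMonoid using (sum)
open import Data.Fin.Base using (toℕ)
open import Data.Integer.Base using (+_)
open import Data.Nat.Base using (ℕ; suc; NonZero)
open import Data.Nat.Coprimality using (Coprime)
open import Data.Product.Base using (∃-syntax; _×_)
open import Data.Rational.Base using (ℚ; ↧ₙ_; _/_; _*_; _-_; +-0-rawMonoid)
open import Relation.Binary.PropositionalEquality.Core using (_≡_)

-- Elements of ℚ are in lowest terms, so ↧ₙ q is the reduced denominator.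
DenominatorPrimeTo : ℕ → ℚ → Set
DenominatorPrimeTo p q = Coprime (↧ₙ q) p

-- Congruence in the ring of rationals with denominator prime to p: a ≡ 0
-- already forces a to lie in this ring, so membership is not demanded separately.
infix 4 _≡_[mod_]
_≡_[mod_] : ℚ → ℚ → ℕ → Set
a ≡ b [mod p ] = ∃[ c ] (DenominatorPrimeTo p c × a - b ≡ (+ p / 1) * c)

-- f 1 + ⋯ + f n; the instance argument lets the summand divide by its index.
∑[1to_] : (n : ℕ) → ((k : ℕ) → .{{NonZero k}} → ℚ) → ℚ
∑[1to n ] f = sum +-0-rawMonoid {n} (λ i → f (suc (toℕ i)))

{-# OPTIONS --safe #-}
module Submission where

-- With Q = (1 + x)² + x² we have 2 (1 + x)³ − x = (x + 2) Q.  Comparing the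
-- coefficients of xᵖ in the p-th powers of both sides, for p odd:
--
-- * On the left it is Σₖ C(p,k) 2ᵏ (−1)ᵖ⁻ᵏ C(3k,k).  The terms k = 0 and k = p
--   are −1 and 2ᵖ C(3p,p) ≡ 3·2ᵖ (mod p²), and for 0 < k < p the term is congruent
--   to p · (2ᵏ/k) C(3k,k) modulo p², because k C(p,k) = p C(p−1,k−1) and
--   C(p−1,k−1) ≡ (−1)ᵖ⁻ᵏ (mod p).
-- * The coefficients of xⁱ, 0 < i < p, in a p-th power are divisible by p (take the
--   logarithmic derivative), so on the right it is 2ᵖ q + 1 modulo p², where q is the
--   coefficient of xᵖ in Qᵖ.  Expanding Qᵖ binomially in both orders,
--   2 q ≡ 2 + 2ᵖ (mod p²).
--
-- Hence twice the sum, multiplied by p, is (2ᵖ − 2)² ≡ 0 modulo p².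

open import Data.Integer.Base as ℤ using (ℤ)
open import Data.Integer.Divisibility.Signed as ℤ using (divides)
import Data.Integer.Properties as ℤ
open import Data.Integer.Tactic.RingSolver using (solve-∀)
open import Data.Nat.Base as ℕ using (zero; suc; NonZero; _<_; z≤n; s≤s)
import Data.Nat.Divisibility as ℕ
import Data.Nat.Properties as ℕ
open import Function.Base using (_∘_)
open import Relation.Binary.PropositionalEquality

module _ where

  open import Algebra.Bundles using (CommutativeSemiring)
  open import Algebra.Properties.CommutativeSemigroup ℕ.+-commutativeSemigroup using (x∙yz≈y∙xz)
  open import Algebra.Structures.Biased using (isCommutativeSemiringˡ)
  open import Data.Fin.Base using (toℕ)
  open import Data.Integer.Base using (ℤ; +_; 0ℤ; 1ℤ; -1ℤ; _+_; _*_; _-_; -_; _^_; ∣_∣)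
  open import Data.Integer.Divisibility.Signed
  open import Data.Nat.Base using (ℕ; _≤_)
  open import Data.Nat.Combinatorics using (_C_; nCk+nC[k+1]≡[n+1]C[k+1]; nCn≡1; nCk≡nC[n∸k])
  open import Data.Nat.DivMod using (m/n*n≡m)
  open import Data.Nat.Primality
    using (Prime; euclidsLemma; prime⇒nonZero; prime⇒nonTrivial)
  open import Data.Product.Base using (_,_)
  open import Data.Sum.Base as Sum using (_⊎_; inj₁; inj₂; fromInj₂)
  open import Level using (0ℓ)
  open import Relation.Binary.Bundles using (Setoid)
  open import Relation.Binary.Definitions using (tri<; tri≈; tri>)
  open import Relation.Nullary using (¬_; contradiction)

  -- Congruences and sums of integers

  -- A record keeps `a`, `b` and `m` inferable; the bare divisibility statement would leave them
  -- hidden under the computing `a - b`.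
  infix 4 _≋_mod_
  record _≋_mod_ (a b m : ℤ) : Set where
    constructor ∣⇒≋
    field ≋⇒∣ : m ∣ a - b
  open _≋_mod_

  private variable
    a b c d m : ℤ

  ≡⇒≋ : a ≡ b → a ≋ b mod m
  ≡⇒≋ {a} refl = ∣⇒≋ (divides 0ℤ (ℤ.+-inverseʳ a))

  ≋-trans : a ≋ b mod m → b ≋ c mod m → a ≋ c mod m
  ≋-trans {a} {b} {m} {c} (∣⇒≋ p) (∣⇒≋ q) = ∣⇒≋ (subst (m ∣_) (lemma a b c) (∣m∣n⇒∣m+n p q))
    where
    lemma : ∀ a b c → (a - b) + (b - c) ≡ a - c
    lemma = solve-∀

  ≋-+ : a ≋ b mod m → c ≋ d mod m → a + c ≋ b + d mod m
  ≋-+ {a} {b} {m} {c} {d} (∣⇒≋ p) (∣⇒≋ q) = ∣⇒≋ (subst (m ∣_) (lemma a b c d) (∣m∣n⇒∣m+n p q))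
    where
    lemma : ∀ a b c d → (a - b) + (c - d) ≡ (a + c) - (b + d)
    lemma = solve-∀

  *-mono-∣ : a ∣ b → c ∣ d → a * c ∣ b * d
  *-mono-∣ {a} {c = c} (divides q refl) (divides r refl) = divides (q * r) (lemma q a r c)
    where
    lemma : ∀ q a r c → (q * a) * (r * c) ≡ (q * r) * (a * c)
    lemma = solve-∀

  -- The modulus grows by the divisor `d` of the multiplier. This is how congruences modulo p,
  -- multiplied by C(p,k), become congruences modulo p².
  ≋-*ˡ : d ∣ c → a ≋ b mod m → c * a ≋ c * b mod (d * m)
  ≋-*ˡ {d} {c} {a} {b} {m} p (∣⇒≋ q) = ∣⇒≋ (subst (d * m ∣_) (lemma c a b) (*-mono-∣ p q))
    where
    lemma : ∀ c a b → c * (a - b) ≡ c * a - c * b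
    lemma = solve-∀

  ≋-*ʳ : ∀ c → a ≋ b mod m → a * c ≋ b * c mod m
  ≋-*ʳ {a} {b} {m} c (∣⇒≋ p) = ∣⇒≋ (subst (m ∣_) (lemma a b c) (∣m⇒∣m*n c p))
    where
    lemma : ∀ a b c → (a - b) * c ≡ a * c - b * c
    lemma = solve-∀

  ∣⇒≋0 : m ∣ a → a ≋ 0ℤ mod m
  ∣⇒≋0 {m} {a} p = ∣⇒≋ (subst (m ∣_) (sym (ℤ.+-identityʳ a)) p)

  1∣ : ∀ a → 1ℤ ∣ a
  1∣ a = divides a (sym (ℤ.*-identityʳ a))

  ∑ : ℕ → (ℕ → ℤ) → ℤ
  ∑ zero    f = 0ℤ
  ∑ (suc n) f = f 0 + ∑ n (f ∘ suc)

  ∑-cong-mod : ∀ n {f g} → (∀ k → k < n → f k ≋ g k mod m) → ∑ n f ≋ ∑ n g mod m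
  ∑-cong-mod zero    h = ≡⇒≋ refl
  ∑-cong-mod (suc n) h = ≋-+ (h 0 (s≤s z≤n)) (∑-cong-mod n λ k k<n → h (suc k) (s≤s k<n))

  ∑-cong : ∀ n {f g} → (∀ k → k < n → f k ≡ g k) → ∑ n f ≡ ∑ n g
  ∑-cong zero    h = refl
  ∑-cong (suc n) h = cong₂ _+_ (h 0 (s≤s z≤n)) (∑-cong n λ k k<n → h (suc k) (s≤s k<n))

  ∑-last : ∀ n f → ∑ (suc n) f ≡ ∑ n f + f n
  ∑-last zero    f = ℤ.+-comm (f 0) 0ℤ
  ∑-last (suc n) f = trans (cong (_+_ (f 0)) (∑-last n (f ∘ suc))) (sym (ℤ.+-assoc (f 0) _ _))

  ∑-+ : ∀ n f g → ∑ n (λ k → f k + g k) ≡ ∑ n f + ∑ n g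
  ∑-+ zero    f g = refl
  ∑-+ (suc n) f g rewrite ∑-+ n (f ∘ suc) (g ∘ suc) = lemma (f 0) (g 0) _ _
    where
    lemma : ∀ a b c d → (a + b) + (c + d) ≡ (a + c) + (b + d)
    lemma = solve-∀

  ∑-*ʳ : ∀ n f a → ∑ n (λ k → f k * a) ≡ ∑ n f * a
  ∑-*ʳ zero    f a = refl
  ∑-*ʳ (suc n) f a rewrite ∑-*ʳ n (f ∘ suc) a = sym (ℤ.*-distribʳ-+ a (f 0) _)

  ∑-∣ : ∀ n {f} → (∀ k → k < n → d ∣ f k) → d ∣ ∑ n f
  ∑-∣ zero    h = divides 0ℤ refl
  ∑-∣ (suc n) h = ∣m∣n⇒∣m+n (h 0 (s≤s z≤n)) (∑-∣ n λ k k<n → h (suc k) (s≤s k<n))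

  -- Power series over ℤ

  Series : Set
  Series = ℕ → ℤ

  infixl 6 _⊞_
  infixl 7 _⊠_

  _⊞_ : Series → Series → Series
  (f ⊞ g) n = f n + g n

  -- The Cauchy product, through (f₀ + x f⁺) g = f₀ g + x (f⁺ g).
  _⊠_ : Series → Series → Series
  (f ⊠ g) zero    = f 0 * g 0
  (f ⊠ g) (suc n) = f 0 * g (suc n) + (f ∘ suc ⊠ g) n

  const : ℤ → Series
  const a zero    = a
  const a (suc n) = 0ℤ

  linear : ℤ → Series
  linear a zero    = 0ℤ
  linear a (suc n) = const a n

  ⊠-cong : ∀ {f f′ g g′} → f ≗ f′ → g ≗ g′ → f ⊠ g ≗ f′ ⊠ g′
  ⊠-cong p q zero    = cong₂ _*_ (p 0) (q 0)
  ⊠-cong p q (suc n) = cong₂ _+_ (cong₂ _*_ (p 0) (q (suc n))) (⊠-cong (p ∘ suc) q n)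

  ⊠-zeroˡ : ∀ g n → ((λ _ → 0ℤ) ⊠ g) n ≡ 0ℤ
  ⊠-zeroˡ g zero    = refl
  ⊠-zeroˡ g (suc n) = trans (ℤ.+-identityˡ _) (⊠-zeroˡ g n)

  const-⊠ : ∀ a g n → (const a ⊠ g) n ≡ a * g n
  const-⊠ a g zero    = refl
  const-⊠ a g (suc n) = trans (cong (_+_ (a * g (suc n))) (⊠-zeroˡ g n)) (ℤ.+-identityʳ _)

  ⊠-distribʳ-⊞ : ∀ h f g → (f ⊞ g) ⊠ h ≗ f ⊠ h ⊞ g ⊠ h
  ⊠-distribʳ-⊞ h f g zero    = ℤ.*-distribʳ-+ (h 0) (f 0) (g 0)
  ⊠-distribʳ-⊞ h f g (suc n)
    rewrite ⊠-distribʳ-⊞ h (f ∘ suc) (g ∘ suc) n = lemma (f 0) (g 0) (h (suc n)) _ _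
    where
    lemma : ∀ a b c u v → (a + b) * c + (u + v) ≡ (a * c + u) + (b * c + v)
    lemma = solve-∀

  ⊠-scaleˡ : ∀ a f g n → ((λ i → a * f i) ⊠ g) n ≡ a * (f ⊠ g) n
  ⊠-scaleˡ a f g zero    = ℤ.*-assoc a (f 0) (g 0)
  ⊠-scaleˡ a f g (suc n) rewrite ⊠-scaleˡ a (f ∘ suc) g n = lemma a (f 0) (g (suc n)) _
    where
    lemma : ∀ a b c u → (a * b) * c + a * u ≡ a * (b * c + u)
    lemma = solve-∀

  ⊠-assoc : ∀ f g h → (f ⊠ g) ⊠ h ≗ f ⊠ (g ⊠ h)
  ⊠-assoc f g h zero    = ℤ.*-assoc (f 0) (g 0) (h 0)
  ⊠-assoc f g h (suc n)
    rewrite ⊠-distribʳ-⊞ h (λ i → f 0 * g (suc i)) (f ∘ suc ⊠ g) n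
          | ⊠-scaleˡ (f 0) (g ∘ suc) h n
          | ⊠-assoc (f ∘ suc) g h n = lemma (f 0) (g 0) (h (suc n)) _ _
    where
    lemma : ∀ a b c u v → (a * b) * c + (a * u + v) ≡ a * (b * c + u) + v
    lemma = solve-∀

  -- The product is defined by peeling off the constant term of the left factor. Peeling off that of
  -- the right factor instead makes commutativity an induction.
  ⊠-tailʳ : ∀ f g n → (f ⊠ g) (suc n) ≡ f (suc n) * g 0 + (f ⊠ (g ∘ suc)) n
  ⊠-tailʳ f g zero    = ℤ.+-comm (f 0 * g 1) (f 1 * g 0)
  ⊠-tailʳ f g (suc n)
    rewrite ⊠-tailʳ (f ∘ suc) g n = lemma (f 0 * g (suc (suc n))) (f (suc (suc n)) * g 0) _
    where
    lemma : ∀ a b c → a + (b + c) ≡ b + (a + c)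
    lemma = solve-∀

  ⊠-comm : ∀ f g → f ⊠ g ≗ g ⊠ f
  ⊠-comm f g zero    = ℤ.*-comm (f 0) (g 0)
  ⊠-comm f g (suc n) = begin
    f 0 * g (suc n) + (f ∘ suc ⊠ g) n ≡⟨ cong₂ _+_ (ℤ.*-comm (f 0) _) (⊠-comm (f ∘ suc) g n) ⟩
    g (suc n) * f 0 + (g ⊠ f ∘ suc) n ≡⟨ ⊠-tailʳ g f n ⟨
    (g ⊠ f) (suc n)                   ∎
    where open ≡-Reasoning

  -- Bundled, with coefficientwise equality, to obtain the laws of exponents and the binomial
  -- theorem for series.
  seriesSemiring : CommutativeSemiring 0ℓ 0ℓ
  seriesSemiring = record
    { Carrier = Series
    ; _≈_ = _≗_
    ; _+_ = _⊞_
    ; _*_ = _⊠_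
    ; 0#  = λ _ → 0ℤ
    ; 1#  = const 1ℤ
    ; isCommutativeSemiring = isCommutativeSemiringˡ record
      { +-isCommutativeMonoid = record
        { isMonoid = record
          { isSemigroup = record
            { isMagma = record
              { isEquivalence = ≗-isEquivalence
              ; ∙-cong = λ p q n → cong₂ _+_ (p n) (q n) }
            ; assoc = λ f g h n → ℤ.+-assoc (f n) (g n) (h n) }
          ; identity = (λ f n → ℤ.+-identityˡ (f n)) , λ f n → ℤ.+-identityʳ (f n) }
        ; comm = λ f g n → ℤ.+-comm (f n) (g n) }
      ; *-isCommutativeMonoid = record
        { isMonoid = record
          { isSemigroup = record
            { isMagma = record { isEquivalence = ≗-isEquivalence ; ∙-cong = ⊠-cong }
            ; assoc = ⊠-assoc }
          ; identity = *-idˡ , λ f n → trans (⊠-comm f _ n) (*-idˡ f n) }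
        ; comm = ⊠-comm }
      ; distribʳ = ⊠-distribʳ-⊞
      ; zeroˡ = ⊠-zeroˡ
      }
    }
    where
    ≗-isEquivalence = Setoid.isEquivalence (ℕ →-setoid ℤ)
    *-idˡ : ∀ f → const 1ℤ ⊠ f ≗ f
    *-idˡ f n = trans (const-⊠ 1ℤ f n) (ℤ.*-identityˡ (f n))

  -- Coefficients of powers: binomial expansion, monomials and powers of a + x.

  open import Algebra.Properties.CommutativeSemiring.Exp seriesSemiring
    using (^-homo-*; ^-assocʳ; ^-distrib-*; ^-congˡ)
    renaming (_^_ to infixr 8 _⊠^_)
  import Algebra.Properties.CommutativeSemiring.Binomial seriesSemiring as Binomial
  open import Algebra.Definitions.RawSemiring (CommutativeSemiring.rawSemiring seriesSemiring)
    using (_×_; sum)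

  sum-coeff : ∀ n (F : ℕ → Series) i → sum {n} (F ∘ toℕ) i ≡ ∑ n (λ k → F k i)
  sum-coeff zero    F i = refl
  sum-coeff (suc n) F i = cong (_+_ (F 0 i)) (sum-coeff n (F ∘ suc) i)

  ×-coeff : ∀ m f i → (m × f) i ≡ + m * f i
  ×-coeff zero    f i = refl
  ×-coeff (suc m) f i = trans (cong (_+_ (f i)) (×-coeff m f i)) (sym (ℤ.suc-* (+ m) (f i)))

  binomial-coeff : ∀ f g n i →
    ((f ⊞ g) ⊠^ n) i ≡ ∑ (suc n) (λ k → + (n C k) * (f ⊠^ k ⊠ g ⊠^ (n ℕ.∸ k)) i)
  binomial-coeff f g n i = begin
    ((f ⊞ g) ⊠^ n) i ≡⟨ Binomial.theorem n f g i ⟩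
    Binomial.binomialExpansion f g n i
      ≡⟨ sum-coeff (suc n) (λ k → (n C k) × (f ⊠^ k ⊠ g ⊠^ (n ℕ.∸ k))) i ⟩
    ∑ (suc n) (λ k → ((n C k) × (f ⊠^ k ⊠ g ⊠^ (n ℕ.∸ k))) i)
      ≡⟨ ∑-cong (suc n) (λ k _ → ×-coeff (n C k) (f ⊠^ k ⊠ g ⊠^ (n ℕ.∸ k)) i) ⟩
    _ ∎
    where open ≡-Reasoning

  coeff₀-^ : ∀ f n → (f ⊠^ n) 0 ≡ f 0 ^ n
  coeff₀-^ f zero    = refl
  coeff₀-^ f (suc n) = cong (f 0 *_) (coeff₀-^ f n)

  linear-⊠ : ∀ b g n → (linear b ⊠ g) (suc n) ≡ b * g n
  linear-⊠ b g n = trans (ℤ.+-identityˡ _) (const-⊠ b g n)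

  linear^-⊠ : ∀ b g m n → (linear b ⊠^ m ⊠ g) (m ℕ.+ n) ≡ b ^ m * g n
  linear^-⊠ b g zero    n = const-⊠ 1ℤ g n
  linear^-⊠ b g (suc m) n = begin
    (linear b ⊠ linear b ⊠^ m ⊠ g) (suc m ℕ.+ n)   ≡⟨ ⊠-assoc (linear b) _ g (suc m ℕ.+ n) ⟩
    (linear b ⊠ (linear b ⊠^ m ⊠ g)) (suc m ℕ.+ n) ≡⟨ linear-⊠ b (linear b ⊠^ m ⊠ g) (m ℕ.+ n) ⟩
    b * (linear b ⊠^ m ⊠ g) (m ℕ.+ n)              ≡⟨ cong (b *_) (linear^-⊠ b g m n) ⟩
    b * (b ^ m * g n)                              ≡⟨ ℤ.*-assoc b _ _ ⟨
    b ^ suc m * g n                                ∎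
    where open ≡-Reasoning

  linear^-⊠-low : ∀ b g {m n} → n < m → (linear b ⊠^ m ⊠ g) n ≡ 0ℤ
  linear^-⊠-low b g {suc m} {n} (s≤s n≤m) = trans (⊠-assoc (linear b) _ g n) (low n n≤m)
    where
    low : ∀ n → n ≤ m → (linear b ⊠ (linear b ⊠^ m ⊠ g)) n ≡ 0ℤ
    low zero    _   = refl
    low (suc n) n<m = trans (linear-⊠ b _ n) (trans (cong (b *_) (linear^-⊠-low b g n<m)) (ℤ.*-zeroʳ b))

  infix 9 _+x
  _+x : ℤ → Series
  a +x = const a ⊞ linear 1ℤ

  +x-⊠ : ∀ a g n → (a +x ⊠ g) (suc n) ≡ a * g (suc n) + g n
  +x-⊠ a g n = begin
    (a +x ⊠ g) (suc n)                             ≡⟨ ⊠-distribʳ-⊞ g (const a) (linear 1ℤ) (suc n) ⟩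
    (const a ⊠ g) (suc n) + (linear 1ℤ ⊠ g) (suc n) ≡⟨ cong₂ _+_ (const-⊠ a g (suc n)) (trans (linear-⊠ 1ℤ g n) (ℤ.*-identityˡ (g n))) ⟩
    a * g (suc n) + g n                            ∎
    where open ≡-Reasoning

  +x-high : ∀ a {n i} → n < i → (a +x ⊠^ n) i ≡ 0ℤ
  +x-high a {zero}  {suc i} _         = refl
  +x-high a {suc n} {suc i} (s≤s n<i) = begin
    (a +x ⊠ a +x ⊠^ n) (suc i)              ≡⟨ +x-⊠ a (a +x ⊠^ n) i ⟩
    a * (a +x ⊠^ n) (suc i) + (a +x ⊠^ n) i ≡⟨ cong₂ (λ u v → a * u + v) (+x-high a (ℕ.m<n⇒m<1+n n<i)) (+x-high a n<i) ⟩
    a * 0ℤ + 0ℤ                             ≡⟨ cong (_+ 0ℤ) (ℤ.*-zeroʳ a) ⟩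
    0ℤ                                      ∎
    where open ≡-Reasoning

  +x-top : ∀ a n → (a +x ⊠^ n) n ≡ 1ℤ
  +x-top a zero    = refl
  +x-top a (suc n) = begin
    (a +x ⊠ a +x ⊠^ n) (suc n)              ≡⟨ +x-⊠ a (a +x ⊠^ n) n ⟩
    a * (a +x ⊠^ n) (suc n) + (a +x ⊠^ n) n ≡⟨ cong₂ (λ u v → a * u + v) (+x-high a (ℕ.n<1+n n)) (+x-top a n) ⟩
    a * 0ℤ + 1ℤ                             ≡⟨ cong (_+ 1ℤ) (ℤ.*-zeroʳ a) ⟩
    1ℤ                                      ∎
    where open ≡-Reasoning

  [1+x]^n-coeff : ∀ n k → (1ℤ +x ⊠^ n) k ≡ + (n C k)
  [1+x]^n-coeff zero    zero    = refl
  [1+x]^n-coeff zero    (suc k) = refl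
  [1+x]^n-coeff (suc n) zero    = trans (ℤ.*-identityˡ _) ([1+x]^n-coeff n 0)
  [1+x]^n-coeff (suc n) (suc k) = begin
    (1ℤ +x ⊠ 1ℤ +x ⊠^ n) (suc k)              ≡⟨ +x-⊠ 1ℤ (1ℤ +x ⊠^ n) k ⟩
    1ℤ * (1ℤ +x ⊠^ n) (suc k) + (1ℤ +x ⊠^ n) k ≡⟨ cong₂ (λ u v → 1ℤ * u + v) ([1+x]^n-coeff n (suc k)) ([1+x]^n-coeff n k) ⟩
    1ℤ * + (n C suc k) + + (n C k)            ≡⟨ cong (_+ + (n C k)) (ℤ.*-identityˡ (+ (n C suc k))) ⟩
    + (n C suc k ℕ.+ n C k)                   ≡⟨ cong +_ (ℕ.+-comm (n C suc k) (n C k)) ⟩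
    + (n C k ℕ.+ n C suc k)                   ≡⟨ cong +_ (nCk+nC[k+1]≡[n+1]C[k+1] n k) ⟩
    + (suc n C suc k)                         ∎
    where open ≡-Reasoning

  -- In Σ fᵢ gₙ₋ᵢ every term with i < n has a factor divisible by `d` and one divisible by `m`; only
  -- i = n survives.
  ⊠-mod : ∀ f g n → (∀ i → i < n → d ∣ f i) → (∀ i → i < n → m ∣ g (suc i)) →
          (f ⊠ g) n ≋ f n * g 0 mod (d * m)
  ⊠-mod f g zero    df eg = ≡⇒≋ refl
  ⊠-mod {d} {m} f g (suc n) df eg = subst ((f ⊠ g) (suc n) ≋_mod (d * m)) (ℤ.+-identityˡ _)
    (≋-+ (∣⇒≋0 (*-mono-∣ (df 0 (s≤s z≤n)) (eg n ℕ.≤-refl)))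
         (⊠-mod (f ∘ suc) g n (λ i i<n → df (suc i) (s≤s i<n)) (λ i i<n → eg i (ℕ.m<n⇒m<1+n i<n))))

  -- The Euler operator x d/dx, with its product and power rules.

  θ : Series → Series
  θ f n = + n * f n

  θ-⊠ : ∀ f g → θ (f ⊠ g) ≗ θ f ⊠ g ⊞ f ⊠ θ g
  θ-⊠ f g zero    = sym (trans (ℤ.+-identityˡ _) (ℤ.*-zeroʳ (f 0)))
  θ-⊠ f g (suc n) = begin
    + suc n * (f 0 * g (suc n) + (f ∘ suc ⊠ g) n)
      ≡⟨ lemma (+ n) (f 0) (g (suc n)) ((f ∘ suc ⊠ g) n) ⟩
    (f ∘ suc ⊠ g) n + (θ (f ∘ suc ⊠ g) n) + f 0 * (+ suc n * g (suc n))
      ≡⟨ cong (λ u → (f ∘ suc ⊠ g) n + u + f 0 * θ g (suc n)) (θ-⊠ (f ∘ suc) g n) ⟩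
    (f ∘ suc ⊠ g) n + ((θ (f ∘ suc) ⊠ g) n + (f ∘ suc ⊠ θ g) n) + f 0 * θ g (suc n)
      ≡⟨ lemma₂ ((f ∘ suc ⊠ g) n) _ _ _ ⟩
    ((f ∘ suc ⊠ g) n + (θ (f ∘ suc) ⊠ g) n) + (f ⊠ θ g) (suc n)
      ≡⟨ cong (_+ (f ⊠ θ g) (suc n)) (⊠-distribʳ-⊞ g (f ∘ suc) (θ (f ∘ suc)) n) ⟨
    ((f ∘ suc ⊞ θ (f ∘ suc)) ⊠ g) n + (f ⊠ θ g) (suc n)
      ≡⟨ cong (_+ (f ⊠ θ g) (suc n)) (⊠-cong {g = g} (λ i → sym (ℤ.suc-* (+ i) (f (suc i)))) (λ _ → refl) n) ⟩
    (θ f ∘ suc ⊠ g) n + (f ⊠ θ g) (suc n)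
      ≡⟨ cong (_+ (f ⊠ θ g) (suc n)) (ℤ.+-identityˡ ((θ f ∘ suc ⊠ g) n)) ⟨
    (θ f ⊠ g) (suc n) + (f ⊠ θ g) (suc n) ∎
    where
    open ≡-Reasoning
    lemma : ∀ n a b c → (1ℤ + n) * (a * b + c) ≡ c + n * c + a * ((1ℤ + n) * b)
    lemma = solve-∀
    lemma₂ : ∀ a b c d → a + (b + c) + d ≡ a + b + (d + c)
    lemma₂ = solve-∀

  -- The logarithmic derivative of a power, free of division. For n = 0 the truncated exponent is
  -- harmless, as the factor n is zero.
  θ-^ : ∀ f n i → θ (f ⊠^ n) i ≡ + n * (f ⊠^ (n ℕ.∸ 1) ⊠ θ f) i
  θ-^ f zero zero    = refl
  θ-^ f zero (suc i) = ℤ.*-zeroʳ (+ suc i)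
  θ-^ f (suc n) i = begin
    θ (f ⊠ f ⊠^ n) i                          ≡⟨ θ-⊠ f (f ⊠^ n) i ⟩
    (θ f ⊠ f ⊠^ n) i + (f ⊠ θ (f ⊠^ n)) i     ≡⟨ cong₂ _+_ (⊠-comm (θ f) (f ⊠^ n) i) (scaled i) ⟩
    h i + + n * (f ⊠ (f ⊠^ (n ℕ.∸ 1) ⊠ θ f)) i ≡⟨ cong (_+_ (h i)) (shift n) ⟩
    h i + + n * h i                           ≡⟨ ℤ.suc-* (+ n) (h i) ⟨
    + suc n * h i                             ∎
    where
    open ≡-Reasoning
    h = f ⊠^ n ⊠ θ f
    scaled : f ⊠ θ (f ⊠^ n) ≗ λ i → + n * (f ⊠ (f ⊠^ (n ℕ.∸ 1) ⊠ θ f)) i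
    scaled i = begin
      (f ⊠ θ (f ⊠^ n)) i                                ≡⟨ ⊠-cong {f} (λ _ → refl) (θ-^ f n) i ⟩
      (f ⊠ (λ j → + n * (f ⊠^ (n ℕ.∸ 1) ⊠ θ f) j)) i    ≡⟨ ⊠-comm f _ i ⟩
      ((λ j → + n * (f ⊠^ (n ℕ.∸ 1) ⊠ θ f) j) ⊠ f) i    ≡⟨ ⊠-scaleˡ (+ n) _ f i ⟩
      + n * (f ⊠^ (n ℕ.∸ 1) ⊠ θ f ⊠ f) i                ≡⟨ cong (+ n *_) (⊠-comm _ f i) ⟩
      + n * (f ⊠ (f ⊠^ (n ℕ.∸ 1) ⊠ θ f)) i              ∎
    shift : ∀ n → + n * (f ⊠ (f ⊠^ (n ℕ.∸ 1) ⊠ θ f)) i ≡ + n * (f ⊠^ n ⊠ θ f) i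
    shift zero    = refl
    shift (suc n) = cong (+ suc n *_) (sym (⊠-assoc f (f ⊠^ n) (θ f) i))

  -- Prime powers of series

  2∣n⊎[-1]^n≡-1 : ∀ n → 2 ℕ.∣ n ⊎ -1ℤ ^ n ≡ -1ℤ
  2∣n⊎[-1]^n≡-1 0 = inj₁ (ℕ.divides 0 refl)
  2∣n⊎[-1]^n≡-1 1 = inj₂ refl
  2∣n⊎[-1]^n≡-1 (suc (suc n)) with 2∣n⊎[-1]^n≡-1 n
  ... | inj₁ 2∣n = inj₁ (ℕ.∣m∣n⇒∣m+n ℕ.∣-refl 2∣n)
  ... | inj₂ eq  = inj₂ (cong (λ s → -1ℤ * (-1ℤ * s)) eq)

  [-1]^n*[-1]^n≡1 : ∀ n → -1ℤ ^ n * -1ℤ ^ n ≡ 1ℤ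
  [-1]^n*[-1]^n≡1 zero    = refl
  [-1]^n*[-1]^n≡1 (suc n) = trans (lemma (-1ℤ ^ n)) ([-1]^n*[-1]^n≡1 n)
    where
    lemma : ∀ s → (-1ℤ * s) * (-1ℤ * s) ≡ s * s
    lemma = solve-∀

  -- The binomial theorem for the constant series 1 + 1, read off at the constant coefficient.
  ∑C≡2^n : ∀ n → ∑ (suc n) (λ k → + (n C k)) ≡ (+ 2) ^ n
  ∑C≡2^n n = begin
    ∑ (suc n) (λ k → + (n C k))
      ≡⟨ ∑-cong (suc n) (λ k _ → trans (sym (ℤ.*-identityʳ (+ (n C k))))
           (cong (+ (n C k) *_) (sym (cong₂ _*_ (1^ k) (1^ (n ℕ.∸ k)))))) ⟩
    ∑ (suc n) (λ k → + (n C k) * (const 1ℤ ⊠^ k ⊠ const 1ℤ ⊠^ (n ℕ.∸ k)) 0)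
      ≡⟨ binomial-coeff (const 1ℤ) (const 1ℤ) n 0 ⟨
    ((const 1ℤ ⊞ const 1ℤ) ⊠^ n) 0
      ≡⟨ coeff₀-^ (const 1ℤ ⊞ const 1ℤ) n ⟩
    (+ 2) ^ n ∎
    where
    open ≡-Reasoning
    1^ : ∀ k → (const 1ℤ ⊠^ k) 0 ≡ 1ℤ
    1^ k = trans (coeff₀-^ (const 1ℤ) k) (ℤ.^-zeroˡ k)

  -- Positivity of n makes the first and the last term distinct.
  ∑-ends : ∀ n f → 0 < n → ∑ (suc n) f ≡ f 0 + (∑ (n ℕ.∸ 1) (f ∘ suc) + f n)
  ∑-ends (suc n) f _ = cong (_+_ (f 0)) (∑-last n (f ∘ suc))

  -- Pascal's rule gives C(n,k+1) = C(n+1,k+1) - C(n,k), where the first term vanishes modulo `d`,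
  -- so each step flips the sign. It is applied with n = p - 1 and d = p.
  nCk≋[-1]^k : ∀ {d} n → (∀ i → i < n → d ∣ + (suc n C suc i)) →
               ∀ k → k ≤ n → + (n C k) ≋ -1ℤ ^ k mod d
  nCk≋[-1]^k {d} n h zero    _   = ≡⇒≋ refl
  nCk≋[-1]^k {d} n h (suc k) k<n =
    ≋-trans (≡⇒≋ pascal) (≋-trans (≋-+ (∣⇒≋0 (h k k<n)) -IH) (≡⇒≋ (ℤ.+-identityˡ (-1ℤ ^ suc k))))
    where
    lemma : ∀ a b → b ≡ (a + b) + -1ℤ * a
    lemma = solve-∀
    pascal : + (n C suc k) ≡ + (suc n C suc k) + -1ℤ * + (n C k)
    pascal = trans (lemma (+ (n C k)) (+ (n C suc k)))
                   (cong (λ c → + c + -1ℤ * + (n C k)) (nCk+nC[k+1]≡[n+1]C[k+1] n k))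
    -IH : -1ℤ * + (n C k) ≋ -1ℤ * -1ℤ ^ k mod d
    -IH = subst (-1ℤ * + (n C k) ≋ -1ℤ * -1ℤ ^ k mod_) (ℤ.*-identityˡ d)
            (≋-*ˡ (1∣ -1ℤ) (nCk≋[-1]^k n h k (ℕ.<⇒≤ k<n)))

  -- With no condition on the constant terms, both extreme terms of the product survive: the first
  -- is split off and `⊠-mod` treats the rest.
  ⊠-mod₂ : ∀ {d m} f g n → 0 < n →
           (∀ i → 0 < i → i < n → d ∣ f i) → (∀ i → 0 < i → i < n → m ∣ g i) →
           (f ⊠ g) n ≋ f 0 * g n + f n * g 0 mod (d * m)
  ⊠-mod₂ f g (suc n) _ df mg =
    ≋-+ {a = f 0 * g (suc n)} (≡⇒≋ refl)
      (⊠-mod (f ∘ suc) g n (λ i i<n → df (suc i) (s≤s z≤n) (s≤s i<n))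
                           (λ i i<n → mg (suc i) (s≤s z≤n) (s≤s i<n)))

  1^-coeff : ∀ n i → 0 < i → (const 1ℤ ⊠^ n) i ≡ 0ℤ
  1^-coeff zero    (suc i) _ = refl
  1^-coeff (suc n) i 0<i =
    trans (const-⊠ 1ℤ (const 1ℤ ⊠^ n) i) (trans (ℤ.*-identityˡ ((const 1ℤ ⊠^ n) i)) (1^-coeff n i 0<i))

  +x-coeff₀ : ∀ a n → (a +x ⊠^ n) 0 ≡ a ^ n
  +x-coeff₀ a n = trans (coeff₀-^ (a +x) n) (cong (_^ n) (ℤ.+-identityʳ a))

  module _ {p : ℕ} (prime : Prime p) where

    0<p : 0 < p
    0<p = ℕ.>-nonZero⁻¹ p {{prime⇒nonZero prime}}

    euclid : ∀ a b → + p ∣ a * b → (+ p ∣ a) ⊎ (+ p ∣ b)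
    euclid a b p∣ab = Sum.map ∣ᵤ⇒∣ ∣ᵤ⇒∣
      (euclidsLemma ∣ a ∣ ∣ b ∣ prime (subst (p ℕ.∣_) (ℤ.abs-* a b) (∣⇒∣ᵤ p∣ab)))

    -- By the power rule i times the coefficient is a multiple of p, and p does not divide i.
    p∣[f^p]ᵢ : ∀ f i → 0 < i → i < p → + p ∣ (f ⊠^ p) i
    p∣[f^p]ᵢ f i 0<i i<p =
      fromInj₂ (λ p∣i → contradiction (ℕ.∣⇒≤ {{ℕ.>-nonZero 0<i}} (∣⇒∣ᵤ p∣i)) (ℕ.<⇒≱ i<p))
        (euclid (+ i) ((f ⊠^ p) i) (divides h (trans (θ-^ f p i) (ℤ.*-comm (+ p) h))))
      where h = (f ⊠^ (p ℕ.∸ 1) ⊠ θ f) i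

    p∣pCi : ∀ i → 0 < i → i < p → + p ∣ + (p C i)
    p∣pCi i 0<i i<p = subst (+ p ∣_) ([1+x]^n-coeff p i) (p∣[f^p]ᵢ (1ℤ +x) i 0<i i<p)

    ⊠-coeffₚ : ∀ f g → ((f ⊠^ p) ⊠ (g ⊠^ p)) p ≋
               (f ⊠^ p) 0 * (g ⊠^ p) p + (f ⊠^ p) p * (g ⊠^ p) 0 mod (+ p * + p)
    ⊠-coeffₚ f g = ⊠-mod₂ (f ⊠^ p) (g ⊠^ p) p 0<p (p∣[f^p]ᵢ f) (p∣[f^p]ᵢ g)

    -- This is C(mp,p) ≡ m (mod p²). Splitting off one factor (1 + x)ᵖ adds its top coefficient 1,
    -- since all the constant terms are 1.
    [1+x]^mp-coeff : ∀ m → ((1ℤ +x ⊠^ m) ⊠^ p) p ≋ + m mod (+ p * + p)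
    [1+x]^mp-coeff zero    = ≡⇒≋ (1^-coeff p p 0<p)
    [1+x]^mp-coeff (suc m) =
      ≋-trans (≡⇒≋ (^-distrib-* (1ℤ +x) g p p))
      (≋-trans (⊠-coeffₚ (1ℤ +x) g)
      (≋-trans (≡⇒≋ coeffs) (≋-+ {a = 1ℤ} (≡⇒≋ refl) ([1+x]^mp-coeff m))))
      where
      open ≡-Reasoning
      g = 1ℤ +x ⊠^ m
      g₀ : (g ⊠^ p) 0 ≡ 1ℤ
      g₀ = trans (coeff₀-^ g p)
           (trans (cong (_^ p) (trans (+x-coeff₀ 1ℤ m) (ℤ.^-zeroˡ m))) (ℤ.^-zeroˡ p))
      coeffs : (1ℤ +x ⊠^ p) 0 * (g ⊠^ p) p + (1ℤ +x ⊠^ p) p * (g ⊠^ p) 0 ≡ 1ℤ + (g ⊠^ p) p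
      coeffs = begin
        (1ℤ +x ⊠^ p) 0 * (g ⊠^ p) p + (1ℤ +x ⊠^ p) p * (g ⊠^ p) 0
          ≡⟨ cong₂ (λ u v → u * (g ⊠^ p) p + v)
               (trans (+x-coeff₀ 1ℤ p) (ℤ.^-zeroˡ p)) (cong₂ _*_ (+x-top 1ℤ p) g₀) ⟩
        1ℤ * (g ⊠^ p) p + 1ℤ
          ≡⟨ cong (_+ 1ℤ) (ℤ.*-identityˡ ((g ⊠^ p) p)) ⟩
        (g ⊠^ p) p + 1ℤ
          ≡⟨ ℤ.+-comm ((g ⊠^ p) p) 1ℤ ⟩
        1ℤ + (g ⊠^ p) p ∎

  -- The central sum

  [1+x]² x² quadratic : Series
  [1+x]²    = 1ℤ +x ⊠^ 2
  x²        = linear 1ℤ ⊠^ 2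
  quadratic = [1+x]² ⊞ x²

  2[1+x]³ : Series
  2[1+x]³ = const (+ 2) ⊠ 1ℤ +x ⊠^ 3

  -- Coefficients up to degree 3 are compared by computation; beyond that both sides vanish.
  cubic-factors : 2[1+x]³ ⊞ linear -1ℤ ≗ (+ 2) +x ⊠ quadratic
  cubic-factors 0 = refl
  cubic-factors 1 = refl
  cubic-factors 2 = refl
  cubic-factors 3 = refl
  cubic-factors (suc (suc (suc (suc n)))) = begin
    (const (+ 2) ⊠ 1ℤ +x ⊠^ 3) (4 ℕ.+ n) + 0ℤ
      ≡⟨ cong (_+ 0ℤ) (const-⊠ (+ 2) (1ℤ +x ⊠^ 3) (4 ℕ.+ n)) ⟩
    + 2 * (1ℤ +x ⊠^ 3) (4 ℕ.+ n) + 0ℤ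
      ≡⟨ cong (λ a → + 2 * a + 0ℤ) (+x-high 1ℤ {3} {4 ℕ.+ n} (s≤s (s≤s (s≤s (s≤s z≤n))))) ⟩
    0ℤ
      ≡⟨ cong₂ (λ a b → + 2 * a + b) (quadratic-high (suc n)) (quadratic-high n) ⟨
    + 2 * quadratic (4 ℕ.+ n) + quadratic (3 ℕ.+ n)
      ≡⟨ +x-⊠ (+ 2) quadratic (3 ℕ.+ n) ⟨
    ((+ 2) +x ⊠ quadratic) (4 ℕ.+ n) ∎
    where
    open ≡-Reasoning
    quadratic-high : ∀ n → quadratic (3 ℕ.+ n) ≡ 0ℤ
    quadratic-high n = cong₂ _+_ (+x-high 1ℤ {2} {3 ℕ.+ n} (s≤s (s≤s (s≤s z≤n))))
      (trans (linear-⊠ 1ℤ (linear 1ℤ ⊠^ 1) (2 ℕ.+ n))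
             (cong (1ℤ *_) (linear-⊠ 1ℤ (const 1ℤ) (1 ℕ.+ n))))

  const^-⊠ : ∀ a g n i → (const a ⊠^ n ⊠ g) i ≡ a ^ n * g i
  const^-⊠ a g zero    i = const-⊠ 1ℤ g i
  const^-⊠ a g (suc n) i = begin
    (const a ⊠ const a ⊠^ n ⊠ g) i   ≡⟨ ⊠-assoc (const a) (const a ⊠^ n) g i ⟩
    (const a ⊠ (const a ⊠^ n ⊠ g)) i ≡⟨ const-⊠ a (const a ⊠^ n ⊠ g) i ⟩
    a * (const a ⊠^ n ⊠ g) i         ≡⟨ cong (a *_) (const^-⊠ a g n i) ⟩
    a * (a ^ n * g i)                ≡⟨ ℤ.*-assoc a (a ^ n) (g i) ⟨
    a ^ suc n * g i                  ∎
    where open ≡-Reasoning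

  -- The power rule for (1 + x)ⁿ at degree k + 1: since θ (1 + x) = x, the right side is n x (1 +
  -- x)ⁿ⁻¹.
  absorption : ∀ n k → + suc k * + (n C suc k) ≡ + n * + ((n ℕ.∸ 1) C k)
  absorption n k = begin
    + suc k * + (n C suc k)                          ≡⟨ cong (+ suc k *_) ([1+x]^n-coeff n (suc k)) ⟨
    θ (1ℤ +x ⊠^ n) (suc k)                           ≡⟨ θ-^ (1ℤ +x) n (suc k) ⟩
    + n * (1ℤ +x ⊠^ (n ℕ.∸ 1) ⊠ θ (1ℤ +x)) (suc k)   ≡⟨ cong (+ n *_) (⊠-comm _ (θ (1ℤ +x)) (suc k)) ⟩
    + n * (θ (1ℤ +x) ⊠ 1ℤ +x ⊠^ (n ℕ.∸ 1)) (suc k)   ≡⟨ cong (+ n *_) (⊠-cong {g = 1ℤ +x ⊠^ (n ℕ.∸ 1)} θ[1+x]≗x (λ _ → refl) (suc k)) ⟩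
    + n * (linear 1ℤ ⊠ 1ℤ +x ⊠^ (n ℕ.∸ 1)) (suc k)   ≡⟨ cong (+ n *_) (linear-⊠ 1ℤ (1ℤ +x ⊠^ (n ℕ.∸ 1)) k) ⟩
    + n * (1ℤ * (1ℤ +x ⊠^ (n ℕ.∸ 1)) k)              ≡⟨ cong (+ n *_) (ℤ.*-identityˡ _) ⟩
    + n * (1ℤ +x ⊠^ (n ℕ.∸ 1)) k                     ≡⟨ cong (+ n *_) ([1+x]^n-coeff (n ℕ.∸ 1) k) ⟩
    + n * + ((n ℕ.∸ 1) C k)                          ∎
    where
    open ≡-Reasoning
    θ[1+x]≗x : θ (1ℤ +x) ≗ linear 1ℤ
    θ[1+x]≗x 0             = refl
    θ[1+x]≗x 1             = refl
    θ[1+x]≗x (suc (suc n)) = ℤ.*-zeroʳ (+ suc (suc n))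

  -- Comparison of the coefficients of xᵖ modulo p².

  module _ {p : ℕ} (prime : Prime p) where

    private
      -- This is C(2j, p - 2k), read as zero when 2k > p. For k + j = p it accompanies C(p,k) in the
      -- expansion of the p-th power of `quadratic`.
      term : ℕ → ℕ → ℤ
      term k j = (x² ⊠^ k ⊠ [1+x]² ⊠^ j) p

      termₖⱼ : ∀ k j → term k j ≡ (linear 1ℤ ⊠^ (2 ℕ.* k) ⊠ 1ℤ +x ⊠^ (2 ℕ.* j)) p
      termₖⱼ k j = ⊠-cong (^-assocʳ (linear 1ℤ) 2 k) (^-assocʳ (1ℤ +x) 2 j) p

      term-high : ∀ k j → p < 2 ℕ.* k → term k j ≡ 0ℤ
      term-high k j p<2k = trans (termₖⱼ k j) (linear^-⊠-low 1ℤ (1ℤ +x ⊠^ (2 ℕ.* j)) p<2k)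

      -- With r = p - 2k one has 2j = p + r, so the term is the coefficient of xʳ in (1 + x)ʳ (1 +
      -- x)ᵖ. As r < p, modulo p only the constant term of (1 + x)ᵖ contributes, leaving the top
      -- coefficient of (1 + x)ʳ.
      term-low : ∀ k j → 0 < k → k ℕ.+ j ≡ p → 2 ℕ.* k < p → term k j ≋ 1ℤ mod + p
      term-low k j 0<k k+j≡p 2k<p =
        ≋-trans (≡⇒≋ coeff)
        -- `⊠-mod` is used with d = 1: divisibility comes from the coefficients of (1 + x)ᵖ alone.
        (≋-trans (subst ((g ⊠ f) r ≋ g r * f 0 mod_) (ℤ.*-identityˡ (+ p))
                   (⊠-mod g f r (λ i _ → 1∣ (g i))
                     (λ i i<r → p∣[f^p]ᵢ prime (1ℤ +x) (suc i) (s≤s z≤n) (ℕ.≤-<-trans i<r r<p))))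
                 (≡⇒≋ (cong₂ _*_ (+x-top 1ℤ r) (trans (+x-coeff₀ 1ℤ p) (ℤ.^-zeroˡ p)))))
        where
        r = p ℕ.∸ 2 ℕ.* k
        f = 1ℤ +x ⊠^ p
        g = 1ℤ +x ⊠^ r
        2k+r≡p : 2 ℕ.* k ℕ.+ r ≡ p
        2k+r≡p = ℕ.m+[n∸m]≡n (ℕ.<⇒≤ 2k<p)
        r<p : r < p
        r<p = subst (r <_) 2k+r≡p (ℕ.m<n+m r (ℕ.<-≤-trans 0<k (ℕ.m≤m+n k (k ℕ.+ 0))))
        2j≡p+r : 2 ℕ.* j ≡ p ℕ.+ r
        2j≡p+r = ℕ.+-cancelˡ-≡ (2 ℕ.* k) (2 ℕ.* j) (p ℕ.+ r) (begin
          2 ℕ.* k ℕ.+ 2 ℕ.* j    ≡⟨ ℕ.*-distribˡ-+ 2 k j ⟨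
          2 ℕ.* (k ℕ.+ j)        ≡⟨ cong (2 ℕ.*_) k+j≡p ⟩
          p ℕ.+ (p ℕ.+ 0)        ≡⟨ cong (p ℕ.+_) (ℕ.+-identityʳ p) ⟩
          p ℕ.+ p                ≡⟨ cong (p ℕ.+_) 2k+r≡p ⟨
          p ℕ.+ (2 ℕ.* k ℕ.+ r)  ≡⟨ x∙yz≈y∙xz p (2 ℕ.* k) r ⟩
          2 ℕ.* k ℕ.+ (p ℕ.+ r)  ∎)
          where
          open ≡-Reasoning
        coeff : term k j ≡ (g ⊠ f) r
        coeff = begin
          term k j ≡⟨ termₖⱼ k j ⟩
          (linear 1ℤ ⊠^ (2 ℕ.* k) ⊠ 1ℤ +x ⊠^ (2 ℕ.* j)) p
            ≡⟨ cong₂ (λ m i → (linear 1ℤ ⊠^ (2 ℕ.* k) ⊠ 1ℤ +x ⊠^ m) i) 2j≡p+r (sym 2k+r≡p) ⟩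
          (linear 1ℤ ⊠^ (2 ℕ.* k) ⊠ 1ℤ +x ⊠^ (p ℕ.+ r)) (2 ℕ.* k ℕ.+ r)
            ≡⟨ linear^-⊠ 1ℤ (1ℤ +x ⊠^ (p ℕ.+ r)) (2 ℕ.* k) r ⟩
          1ℤ ^ (2 ℕ.* k) * (1ℤ +x ⊠^ (p ℕ.+ r)) r
            ≡⟨ cong (_* (1ℤ +x ⊠^ (p ℕ.+ r)) r) (ℤ.^-zeroˡ (2 ℕ.* k)) ⟩
          1ℤ * (1ℤ +x ⊠^ (p ℕ.+ r)) r
            ≡⟨ ℤ.*-identityˡ _ ⟩
          (1ℤ +x ⊠^ (p ℕ.+ r)) r
            ≡⟨ ^-homo-* (1ℤ +x) p r r ⟩
          (f ⊠ g) r
            ≡⟨ ⊠-comm f g r ⟩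
          (g ⊠ f) r ∎
          where open ≡-Reasoning

      term-pair< : ∀ k j → 0 < k → k ℕ.+ j ≡ p → 2 ℕ.* k < p → term k j + term j k ≋ 1ℤ mod + p
      term-pair< k j 0<k k+j≡p 2k<p =
        ≋-+ {b = 1ℤ} {d = 0ℤ} (term-low k j 0<k k+j≡p 2k<p) (≡⇒≋ (term-high j k p<2j))
        where
        p<2j : p < 2 ℕ.* j
        p<2j = ℕ.+-cancelˡ-< (2 ℕ.* k) p (2 ℕ.* j) (subst (2 ℕ.* k ℕ.+ p <_) 2p≡ (ℕ.+-monoˡ-< p 2k<p))
          where
          2p≡ : p ℕ.+ p ≡ 2 ℕ.* k ℕ.+ 2 ℕ.* j
          2p≡ = trans (cong (p ℕ.+_) (sym (ℕ.+-identityʳ p)))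
                      (trans (cong (2 ℕ.*_) (sym k+j≡p)) (ℕ.*-distribˡ-+ 2 k j))

      -- As p is odd, exactly one of k and j lies below p/2; its term is 1 modulo p and the other
      -- one vanishes.
      term-pair : ¬ 2 ℕ.∣ p → ∀ k j → 0 < k → 0 < j → k ℕ.+ j ≡ p → term k j + term j k ≋ 1ℤ mod + p
      term-pair odd k j 0<k 0<j k+j≡p with ℕ.<-cmp (2 ℕ.* k) p
      ... | tri< 2k<p _ _ = term-pair< k j 0<k k+j≡p 2k<p
      ... | tri≈ _ 2k≡p _ = contradiction (ℕ.divides k (trans (sym 2k≡p) (ℕ.*-comm 2 k))) odd
      ... | tri> _ _ p<2k = ≋-trans (≡⇒≋ (ℤ.+-comm (term k j) (term j k)))
                              (term-pair< j k 0<j (trans (ℕ.+-comm j k) k+j≡p) 2j<p)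
        where
        2j<p : 2 ℕ.* j < p
        2j<p = ℕ.+-cancelˡ-< p (2 ℕ.* j) p (subst (p ℕ.+ 2 ℕ.* j <_) 2p≡ (ℕ.+-monoˡ-< (2 ℕ.* j) p<2k))
          where
          2p≡ : 2 ℕ.* k ℕ.+ 2 ℕ.* j ≡ p ℕ.+ p
          2p≡ = trans (sym (ℕ.*-distribˡ-+ 2 k j))
                      (trans (cong (2 ℕ.*_) k+j≡p) (cong (p ℕ.+_) (ℕ.+-identityʳ p)))

    -- Equal to 2ᵖ - 2, as `2^p≡2+innerSum` shows.
    innerSum : ℤ
    innerSum = ∑ (p ℕ.∸ 1) (λ k → + (p C suc k))

    -- Adding the binomial expansions in both orders puts `term k j` next to `term j k`. An inner
    -- pair is 1 modulo p and carries C(p,k), divisible by p, so it is C(p,k) modulo p². Each end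
    -- pair is C(2p,p) ≡ 2.
    quadratic^p-coeff : ¬ 2 ℕ.∣ p →
      (quadratic ⊠^ p) p + (quadratic ⊠^ p) p ≋ + 4 + innerSum mod (+ p * + p)
    quadratic^p-coeff odd = ≋-trans (≡⇒≋ expand)
      (≋-trans (≋-+ {b = + 2} first (≋-+ {b = innerSum} middle last)) (≡⇒≋ (lemma innerSum)))
      where
      open ≡-Reasoning
      P = + p * + p
      pair left right : ℕ → ℤ
      left  k = + (p C k) * term k (p ℕ.∸ k)
      right k = + (p C k) * ([1+x]² ⊠^ k ⊠ x² ⊠^ (p ℕ.∸ k)) p
      pair k = + (p C k) * (term k (p ℕ.∸ k) + term (p ℕ.∸ k) k)
      lemma : ∀ a → + 2 + (a + + 2) ≡ + 4 + a
      lemma = solve-∀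
      expand : (quadratic ⊠^ p) p + (quadratic ⊠^ p) p ≡
               pair 0 + (∑ (p ℕ.∸ 1) (pair ∘ suc) + pair p)
      expand = begin
        (quadratic ⊠^ p) p + (quadratic ⊠^ p) p
          ≡⟨ cong₂ _+_ (^-congˡ p (λ n → ℤ.+-comm ([1+x]² n) (x² n)) p) refl ⟩
        ((x² ⊞ [1+x]²) ⊠^ p) p + (quadratic ⊠^ p) p
          ≡⟨ cong₂ _+_ (binomial-coeff x² [1+x]² p p) (binomial-coeff [1+x]² x² p p) ⟩
        ∑ (suc p) left + ∑ (suc p) right
          ≡⟨ ∑-+ (suc p) left right ⟨
        ∑ (suc p) (λ k → left k + right k)
          ≡⟨ ∑-cong (suc p) (λ k _ →
               trans (cong (λ a → left k + + (p C k) * a) (⊠-comm ([1+x]² ⊠^ k) (x² ⊠^ (p ℕ.∸ k)) p))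
                     (sym (ℤ.*-distribˡ-+ (+ (p C k)) (term k (p ℕ.∸ k)) (term (p ℕ.∸ k) k)))) ⟩
        ∑ (suc p) pair
          ≡⟨ ∑-ends p pair (0<p prime) ⟩
        pair 0 + (∑ (p ℕ.∸ 1) (pair ∘ suc) + pair p) ∎
      p<2p : p < 2 ℕ.* p
      p<2p = ℕ.m<m+n p (subst (0 <_) (sym (ℕ.+-identityʳ p)) (0<p prime))
      term₀ₚ : term 0 p ≋ + 2 mod P
      term₀ₚ = ≋-trans (≡⇒≋ (trans (const-⊠ 1ℤ ([1+x]² ⊠^ p) p) (ℤ.*-identityˡ _))) ([1+x]^mp-coeff prime 2)
      first : pair 0 ≋ + 2 mod P
      first = ≋-trans (≡⇒≋ (ℤ.*-identityˡ _)) (≋-+ {b = + 2} {d = 0ℤ} term₀ₚ (≡⇒≋ (term-high p 0 p<2p)))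
      last : pair p ≋ + 2 mod P
      last = ≋-trans (≡⇒≋ (begin
          pair p ≡⟨ cong (λ c → + c * (term p (p ℕ.∸ p) + term (p ℕ.∸ p) p)) (nCn≡1 p) ⟩
          1ℤ * (term p (p ℕ.∸ p) + term (p ℕ.∸ p) p) ≡⟨ ℤ.*-identityˡ _ ⟩
          term p (p ℕ.∸ p) + term (p ℕ.∸ p) p ≡⟨ cong (λ i → term p i + term i p) (ℕ.n∸n≡0 p) ⟩
          term p 0 + term 0 p ≡⟨ cong (_+ term 0 p) (term-high p 0 p<2p) ⟩
          0ℤ + term 0 p ≡⟨ ℤ.+-identityˡ (term 0 p) ⟩
          term 0 p ∎)) term₀ₚ
      middle : ∑ (p ℕ.∸ 1) (pair ∘ suc) ≋ innerSum mod P
      middle = ∑-cong-mod (p ℕ.∸ 1) λ k k<p-1 →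
        -- Position k of the sum carries the binomial coefficient with lower index k + 1, hence the
        -- shifted bound.
        let k<p = ℕ.pred-cancel-< {suc k} k<p-1 in
        ≋-trans (≋-*ˡ (p∣pCi prime (suc k) (s≤s z≤n) k<p)
                      (term-pair odd (suc k) (p ℕ.∸ suc k) (s≤s z≤n) (ℕ.m<n⇒0<n∸m k<p) (ℕ.m+[n∸m]≡n (ℕ.<⇒≤ k<p))))
                (≡⇒≋ (ℤ.*-identityʳ (+ (p C suc k))))

    p∣innerSum : + p ∣ innerSum
    p∣innerSum = ∑-∣ (p ℕ.∸ 1) λ k k<p-1 → p∣pCi prime (suc k) (s≤s z≤n) (ℕ.pred-cancel-< {suc k} k<p-1)

    2^p≡2+innerSum : (+ 2) ^ p ≡ + 2 + innerSum
    2^p≡2+innerSum = begin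
      (+ 2) ^ p                      ≡⟨ ∑C≡2^n p ⟨
      ∑ (suc p) (λ k → + (p C k))    ≡⟨ ∑-ends p (λ k → + (p C k)) (0<p prime) ⟩
      1ℤ + (innerSum + + (p C p))    ≡⟨ cong (λ c → 1ℤ + (innerSum + + c)) (nCn≡1 p) ⟩
      1ℤ + (innerSum + 1ℤ)           ≡⟨ lemma innerSum ⟩
      + 2 + innerSum                 ∎
      where
      open ≡-Reasoning
      lemma : ∀ a → 1ℤ + (a + 1ℤ) ≡ + 2 + a
      lemma = solve-∀

    -- This is (-1)ᵖ⁻ᵏ 2ᵏ C(3k,k), with the last factor kept as a coefficient of a power of (1 +
    -- x)³.
    signed : ℕ → ℤ
    signed k = -1ℤ ^ (p ℕ.∸ k) * ((+ 2) ^ k * ((1ℤ +x ⊠^ 3) ⊠^ k) k)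

    centralSum : ℤ
    centralSum = ∑ (p ℕ.∸ 1) (λ k → + (p C suc k) * signed (suc k))

    cubic^p-coeff : ¬ 2 ℕ.∣ p → ((2[1+x]³ ⊞ linear -1ℤ) ⊠^ p) p ≡
                    -1ℤ + (centralSum + (+ 2) ^ p * ((1ℤ +x ⊠^ 3) ⊠^ p) p)
    cubic^p-coeff odd = begin
      ((2[1+x]³ ⊞ linear -1ℤ) ⊠^ p) p
        ≡⟨ binomial-coeff 2[1+x]³ (linear -1ℤ) p p ⟩
      ∑ (suc p) (λ k → + (p C k) * (2[1+x]³ ⊠^ k ⊠ linear -1ℤ ⊠^ (p ℕ.∸ k)) p)
        ≡⟨ ∑-cong (suc p) (λ k k≤p → cong (+ (p C k) *_) (coeff k (ℕ.s≤s⁻¹ k≤p))) ⟩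
      ∑ (suc p) (λ k → + (p C k) * signed k)
        ≡⟨ ∑-ends p (λ k → + (p C k) * signed k) (0<p prime) ⟩
      1ℤ * signed 0 + (centralSum + + (p C p) * signed p)
        ≡⟨ cong₂ (λ u v → u + (centralSum + v)) signed₀ signedₚ ⟩
      -1ℤ + (centralSum + (+ 2) ^ p * ((1ℤ +x ⊠^ 3) ⊠^ p) p) ∎
      where
      open ≡-Reasoning
      [1+x]³ = 1ℤ +x ⊠^ 3
      coeff : ∀ k → k ≤ p → (2[1+x]³ ⊠^ k ⊠ linear -1ℤ ⊠^ (p ℕ.∸ k)) p ≡ signed k
      coeff k k≤p = begin
        (2[1+x]³ ⊠^ k ⊠ linear -1ℤ ⊠^ j) p        ≡⟨ ⊠-comm (2[1+x]³ ⊠^ k) (linear -1ℤ ⊠^ j) p ⟩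
        (linear -1ℤ ⊠^ j ⊠ 2[1+x]³ ⊠^ k) p        ≡⟨ cong (linear -1ℤ ⊠^ j ⊠ 2[1+x]³ ⊠^ k) (ℕ.m∸n+n≡m k≤p) ⟨
        (linear -1ℤ ⊠^ j ⊠ 2[1+x]³ ⊠^ k) (j ℕ.+ k) ≡⟨ linear^-⊠ -1ℤ (2[1+x]³ ⊠^ k) j k ⟩
        -1ℤ ^ j * (2[1+x]³ ⊠^ k) k                ≡⟨ cong (-1ℤ ^ j *_) (^-distrib-* (const (+ 2)) [1+x]³ k k) ⟩
        -1ℤ ^ j * (const (+ 2) ⊠^ k ⊠ [1+x]³ ⊠^ k) k ≡⟨ cong (-1ℤ ^ j *_) (const^-⊠ (+ 2) ([1+x]³ ⊠^ k) k k) ⟩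
        signed k                                  ∎
        where j = p ℕ.∸ k
      signed₀ : 1ℤ * signed 0 ≡ -1ℤ
      signed₀ = trans (ℤ.*-identityˡ (signed 0)) (trans (ℤ.*-identityʳ (-1ℤ ^ p))
                  (fromInj₂ (λ 2∣p → contradiction 2∣p odd) (2∣n⊎[-1]^n≡-1 p)))
      signedₚ : + (p C p) * signed p ≡ (+ 2) ^ p * ([1+x]³ ⊠^ p) p
      signedₚ = begin
        + (p C p) * signed p ≡⟨ cong (λ c → + c * signed p) (nCn≡1 p) ⟩
        1ℤ * signed p        ≡⟨ ℤ.*-identityˡ (signed p) ⟩
        signed p             ≡⟨ cong (λ j → -1ℤ ^ j * ((+ 2) ^ p * ([1+x]³ ⊠^ p) p)) (ℕ.n∸n≡0 p) ⟩
        1ℤ * ((+ 2) ^ p * ([1+x]³ ⊠^ p) p) ≡⟨ ℤ.*-identityˡ _ ⟩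
        (+ 2) ^ p * ([1+x]³ ⊠^ p) p ∎

    p²∣2centralSum : ¬ 2 ℕ.∣ p → + p * + p ∣ + 2 * centralSum
    p²∣2centralSum odd = subst (+ p * + p ∣_) (sym (lemma centralSum innerSum w s))
      (∣m∣n⇒∣m+n (∣m∣n⇒∣m+n (∣m∣n⇒∣m+n
        (∣n⇒∣m*n (+ 2) (≋⇒∣ factored))
        (∣n⇒∣m*n (- (+ 2 * t)) (≋⇒∣ ([1+x]^mp-coeff prime 3))))
        (∣n⇒∣m*n t (≋⇒∣ (quadratic^p-coeff odd))))
        (*-mono-∣ p∣innerSum p∣innerSum))
      where
      open ≡-Reasoning
      t w s : ℤ
      t = + 2 + innerSum
      w = ((1ℤ +x ⊠^ 3) ⊠^ p) p
      s = (quadratic ⊠^ p) p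
      -- With c = 2ᵖ − 2, w ≡ 3 and 2 s ≡ 4 + c, twice the central sum is c² modulo p².
      lemma : ∀ m c w s → + 2 * m ≡
        + 2 * ((-1ℤ + (m + (+ 2 + c) * w)) - ((+ 2 + c) * s + 1ℤ))
        + - (+ 2 * (+ 2 + c)) * (w - + 3)
        + (+ 2 + c) * ((s + s) - (+ 4 + c))
        + c * c
      lemma = solve-∀
      constants : ((+ 2) +x ⊠^ p) 0 * s + ((+ 2) +x ⊠^ p) p * (quadratic ⊠^ p) 0 ≡ t * s + 1ℤ
      constants = cong₂ (λ u v → u * s + v)
        (trans (+x-coeff₀ (+ 2) p) 2^p≡2+innerSum)
        (cong₂ _*_ (+x-top (+ 2) p) (trans (coeff₀-^ quadratic p) (ℤ.^-zeroˡ p)))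
      factored : -1ℤ + (centralSum + t * w) ≋ t * s + 1ℤ mod (+ p * + p)
      factored = ≋-trans (≡⇒≋ (begin
        -1ℤ + (centralSum + t * w)
          ≡⟨ cong (λ u → -1ℤ + (centralSum + u * w)) 2^p≡2+innerSum ⟨
        -1ℤ + (centralSum + (+ 2) ^ p * w)
          ≡⟨ cubic^p-coeff odd ⟨
        ((2[1+x]³ ⊞ linear -1ℤ) ⊠^ p) p
          ≡⟨ ^-congˡ p cubic-factors p ⟩
        (((+ 2) +x ⊠ quadratic) ⊠^ p) p
          ≡⟨ ^-distrib-* ((+ 2) +x) quadratic p p ⟩
        ((+ 2) +x ⊠^ p ⊠ quadratic ⊠^ p) p ∎))
        (≋-trans (⊠-coeffₚ prime ((+ 2) +x) quadratic) (≡⇒≋ constants))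

  pos-^ : ∀ m n → + (m ℕ.^ n) ≡ (+ m) ^ n
  pos-^ m zero    = refl
  pos-^ m (suc n) = trans (ℤ.pos-* m (m ℕ.^ n)) (cong (+ m *_) (pos-^ m n))

  module _ {p : ℕ} (prime : Prime p) where

    private instance
      p≢0 : ℕ.NonZero p
      p≢0 = prime⇒nonZero prime

    -- An integer representing the summand of index k + 1 modulo p.
    residue : ℕ → ℤ
    residue k = + ((p C suc k) ℕ./ p) * signed prime (suc k)

    private
      pC≡ : ∀ k → suc k < p → + (p C suc k) ≡ + ((p C suc k) ℕ./ p) * + p
      pC≡ k k<p = trans (cong +_ (sym (m/n*n≡m (∣⇒∣ᵤ (p∣pCi prime (suc k) (s≤s z≤n) k<p)))))
                        (ℤ.pos-* ((p C suc k) ℕ./ p) p)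

    p∣∑residue : ¬ 2 ℕ.∣ p → + p ∣ ∑ (p ℕ.∸ 1) residue
    p∣∑residue odd = fromInj₂ (λ p∣2 → contradiction (2∣p p∣2) odd)
      (euclid prime (+ 2) (∑ (p ℕ.∸ 1) residue)
        (*-cancelʳ-∣ (+ p) (subst (+ p * + p ∣_) eq (p²∣2centralSum prime odd))))
      where
      open ≡-Reasoning
      2∣p : + p ∣ + 2 → 2 ℕ.∣ p
      2∣p p∣2 = ℕ.∣-reflexive
        (ℕ.≤-antisym (ℕ.nonTrivial⇒n>1 p {{prime⇒nonTrivial prime}}) (ℕ.∣⇒≤ (∣⇒∣ᵤ p∣2)))
      lemma : ∀ b p s → (b * p) * s ≡ (b * s) * p
      lemma = solve-∀
      eq : + 2 * centralSum prime ≡ (+ 2 * ∑ (p ℕ.∸ 1) residue) * + p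
      eq = begin
        + 2 * centralSum prime
          ≡⟨ cong (+ 2 *_) (∑-cong (p ℕ.∸ 1) λ k k<p-1 →
               trans (cong (_* signed prime (suc k)) (pC≡ k (ℕ.pred-cancel-< {suc k} k<p-1)))
                     (lemma (+ ((p C suc k) ℕ./ p)) (+ p) (signed prime (suc k)))) ⟩
        + 2 * ∑ (p ℕ.∸ 1) (λ k → residue k * + p)
          ≡⟨ cong (+ 2 *_) (∑-*ʳ (p ℕ.∸ 1) residue (+ p)) ⟩
        + 2 * (∑ (p ℕ.∸ 1) residue * + p)
          ≡⟨ ℤ.*-assoc (+ 2) (∑ (p ℕ.∸ 1) residue) (+ p) ⟨
        (+ 2 * ∑ (p ℕ.∸ 1) residue) * + p ∎

    [1+k]residue : ∀ k → suc k < p →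
      + suc k * residue k ≋ + (2 ℕ.^ suc k) * + ((3 ℕ.* suc k) C suc k) mod + p
    [1+k]residue k k<p = ≋-trans (≡⇒≋ step) (≋-trans (≋-*ʳ (sign * w) C≋sign) (≡⇒≋ finish))
      where
      open ≡-Reasoning
      n = p ℕ.∸ 1
      j = p ℕ.∸ suc k
      C/p = + ((p C suc k) ℕ./ p)
      sign w : ℤ
      sign = -1ℤ ^ j
      w = (+ 2) ^ suc k * ((1ℤ +x ⊠^ 3) ⊠^ suc k) (suc k)
      p-1+1≡p : suc n ≡ p
      p-1+1≡p = ℕ.suc-pred p
      k≤n : k ≤ n
      k≤n = ℕ.≤-pred (ℕ.≤-trans (ℕ.<⇒≤ k<p) (ℕ.≤-reflexive (sym p-1+1≡p)))
      kb≡C : + suc k * C/p ≡ + (n C k)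
      kb≡C = ℤ.*-cancelʳ-≡ _ _ (+ p) (begin
        + suc k * C/p * + p        ≡⟨ ℤ.*-assoc (+ suc k) C/p (+ p) ⟩
        + suc k * (C/p * + p)      ≡⟨ cong (+ suc k *_) (pC≡ k k<p) ⟨
        + suc k * + (p C suc k)  ≡⟨ absorption p k ⟩
        + p * + (n C k)          ≡⟨ ℤ.*-comm (+ p) (+ (n C k)) ⟩
        + (n C k) * + p          ∎)
      C≋sign : + (n C k) ≋ sign mod + p
      C≋sign = ≋-trans
        (≡⇒≋ (cong +_ (trans (nCk≡nC[n∸k] k≤n) (cong (n C_) (ℕ.∸-+-assoc p 1 k)))))
        (nCk≋[-1]^k n (λ i i<n → subst (λ m → + p ∣ + (m C suc i)) (sym p-1+1≡p)
                         (p∣pCi prime (suc i) (s≤s z≤n) (ℕ.pred-cancel-< {suc i} i<n)))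
          j (ℕ.∸-monoʳ-≤ p (s≤s z≤n)))
      step : + suc k * residue k ≡ + (n C k) * (sign * w)
      step = trans (sym (ℤ.*-assoc (+ suc k) C/p (sign * w))) (cong (_* (sign * w)) kb≡C)
      finish : sign * (sign * w) ≡ + (2 ℕ.^ suc k) * + ((3 ℕ.* suc k) C suc k)
      finish = begin
        sign * (sign * w) ≡⟨ ℤ.*-assoc sign sign w ⟨
        sign * sign * w   ≡⟨ cong (_* w) ([-1]^n*[-1]^n≡1 j) ⟩
        1ℤ * w            ≡⟨ ℤ.*-identityˡ w ⟩
        w                 ≡⟨ cong₂ _*_ (sym (pos-^ 2 (suc k)))
                               (trans (^-assocʳ (1ℤ +x) 3 (suc k) (suc k)) ([1+x]^n-coeff (3 ℕ.* suc k) (suc k))) ⟩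
        + (2 ℕ.^ suc k) * + ((3 ℕ.* suc k) C suc k) ∎

open import Defs
open import Data.Integer.Base using (+_)
open import Data.Nat.Base using (ℕ; _∸_; _^_) renaming (_*_ to _ℕ*_)
open import Data.Nat.Combinatorics using (_C_)
open import Data.Nat.Primality using (Prime)
open import Data.Rational.Base using (_/_; _*_; 0ℚ)
open import Algebra.Definitions.RawMonoid using (sum)
open import Data.Fin.Base using (toℕ)
open import Data.Integer.GCD using (gcd)
open import Data.Nat.Coprimality as Coprime using (Coprime; prime⇒coprime)
open import Data.Nat.Primality using (prime⇒irreducible)
open import Data.Product.Base using (_,_)
open import Data.Rational.Base as ℚ using (ℚ; ↥_; ↧_; ↧ₙ_; _+_; _-_; toℚᵘ; +-0-rawMonoid)
import Data.Rational.Properties as ℚ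
open import Data.Rational.Solver using (module +-*-Solver)
open import Data.Rational.Unnormalised.Base as ℚᵘ using (mkℚᵘ; _≃_; *≡*)
import Data.Rational.Unnormalised.Properties as ℚᵘ
open import Data.Sum.Base using (inj₂; [_,_]′)
open import Relation.Nullary using (¬_)
open import Relation.Nullary.Decidable.Core using (toSum)

-- Rationals with denominator prime to p

Coprime-∣ˡ : ∀ {m n p} → m ℕ.∣ n → Coprime n p → Coprime m p
Coprime-∣ˡ m∣n c (d∣m , d∣p) = c (ℕ.∣-trans d∣m m∣n , d∣p)

Coprime-*ˡ : ∀ {m n p} → Coprime m p → Coprime n p → Coprime (m ℕ.* n) p
Coprime-*ˡ c c′ (d∣mn , d∣p) =
  c′ (Coprime.coprime-divisor (λ (e∣d , e∣m) → c (e∣m , ℕ.∣-trans e∣d d∣p)) d∣mn , d∣p)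

DenominatorPrimeTo-/ : ∀ {p} i n .{{_ : NonZero n}} → Coprime n p → DenominatorPrimeTo p (i / n)
DenominatorPrimeTo-/ i n = Coprime-∣ˡ
  (ℤ.∣⇒∣ᵤ (divides (gcd i (+ n)) (trans (sym (ℚ.↧-/ i n)) (ℤ.*-comm (↧ (i / n)) _))))

DenominatorPrimeTo-+ : ∀ {p} a b → DenominatorPrimeTo p a → DenominatorPrimeTo p b →
                       DenominatorPrimeTo p (a + b)
DenominatorPrimeTo-+ a b c d = Coprime-∣ˡ
  (subst (↧ₙ (a + b) ℕ.∣_) (ℤ.abs-* (↧ a) (↧ b))
    (ℤ.∣⇒∣ᵤ {↧ (a + b)} {↧ a ℤ.* ↧ b} (divides g (trans (sym (ℚ.↧-+ a b)) (ℤ.*-comm (↧ (a + b)) g)))))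
  (Coprime-*ˡ c d)
  where g = gcd (↥ a ℤ.* ↧ b ℤ.+ ↥ b ℤ.* ↧ a) (↧ a ℤ.* ↧ b)

private variable
  p : ℕ

mod-refl : ∀ a → a ≡ a [mod p ]
mod-refl {p} a = 0ℚ , DenominatorPrimeTo-/ (+ 0) 1 (Coprime.1-coprimeTo p) ,
  trans (ℚ.+-inverseʳ a) (sym (ℚ.*-zeroʳ (+ p / 1)))

mod-trans : ∀ a b c → a ≡ b [mod p ] → b ≡ c [mod p ] → a ≡ c [mod p ]
mod-trans {p} a b c (x , dx , eqx) (y , dy , eqy) =
  x + y , DenominatorPrimeTo-+ x y dx dy , (begin
    a - c                 ≡⟨ +-*-Solver.solve 3 (λ a b c → a :- c := (a :- b) :+ (b :- c)) refl a b c ⟩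
    (a - b) + (b - c)     ≡⟨ cong₂ _+_ eqx eqy ⟩
    (+ p / 1) * x + (+ p / 1) * y ≡⟨ ℚ.*-distribˡ-+ (+ p / 1) x y ⟨
    (+ p / 1) * (x + y)   ∎)
  where
  open ≡-Reasoning
  open +-*-Solver

mod-+ : ∀ a b c d → a ≡ b [mod p ] → c ≡ d [mod p ] → a + c ≡ b + d [mod p ]
mod-+ {p} a b c d (x , dx , eqx) (y , dy , eqy) =
  x + y , DenominatorPrimeTo-+ x y dx dy , (begin
    (a + c) - (b + d)
      ≡⟨ +-*-Solver.solve 4 (λ a b c d → (a :+ c) :- (b :+ d) := (a :- b) :+ (c :- d)) refl a b c d ⟩
    (a - b) + (c - d)     ≡⟨ cong₂ _+_ eqx eqy ⟩
    (+ p / 1) * x + (+ p / 1) * y ≡⟨ ℚ.*-distribˡ-+ (+ p / 1) x y ⟨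
    (+ p / 1) * (x + y)   ∎)
  where
  open ≡-Reasoning
  open +-*-Solver

toℚᵘ-/ : ∀ i n → toℚᵘ (i / suc n) ≃ mkℚᵘ i n
toℚᵘ-/ i n = ℚ.toℚᵘ-fromℚᵘ (mkℚᵘ i n)

/1-homo-+ : ∀ i j → (i ℤ.+ j) / 1 ≡ i / 1 + j / 1
/1-homo-+ i j = ℚ.toℚᵘ-injective (begin
  toℚᵘ ((i ℤ.+ j) / 1)          ≈⟨ toℚᵘ-/ (i ℤ.+ j) 0 ⟩
  mkℚᵘ (i ℤ.+ j) 0              ≈⟨ *≡* (lemma i j) ⟩
  mkℚᵘ i 0 ℚᵘ.+ mkℚᵘ j 0        ≈⟨ ℚᵘ.+-cong (toℚᵘ-/ i 0) (toℚᵘ-/ j 0) ⟨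
  toℚᵘ (i / 1) ℚᵘ.+ toℚᵘ (j / 1) ≈⟨ ℚ.toℚᵘ-homo-+ (i / 1) (j / 1) ⟨
  toℚᵘ (i / 1 + j / 1)          ∎)
  where
  open import Relation.Binary.Reasoning.Setoid ℚᵘ.≃-setoid
  lemma : ∀ i j → (i ℤ.+ j) ℤ.* + 1 ≡ (i ℤ.* + 1 ℤ.+ j ℤ.* + 1) ℤ.* + 1
  lemma = solve-∀

cross-multiply : ∀ a c z m t k .{{_ : NonZero k}} → a ℤ.* c ℤ.- + k ℤ.* z ≡ t ℤ.* m →
                 (a / k) * (c / 1) - z / 1 ≡ (m / 1) * (t / k)
cross-multiply a c z m t (suc k) eq = ℚ.toℚᵘ-injective (begin
  toℚᵘ (x - z / 1)                   ≈⟨ ℚ.toℚᵘ-homo-+ x _ ⟩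
  toℚᵘ x ℚᵘ.+ toℚᵘ (ℚ.- (z / 1))
    ≈⟨ ℚᵘ.+-cong (ℚ.toℚᵘ-homo-* (a / suc k) (c / 1)) (ℚ.toℚᵘ-homo‿- (z / 1)) ⟩
  toℚᵘ (a / suc k) ℚᵘ.* toℚᵘ (c / 1) ℚᵘ.- toℚᵘ (z / 1)
    ≈⟨ ℚᵘ.+-cong (ℚᵘ.*-cong (toℚᵘ-/ a k) (toℚᵘ-/ c 0)) (ℚᵘ.-‿cong (toℚᵘ-/ z 0)) ⟩
  mkℚᵘ a k ℚᵘ.* mkℚᵘ c 0 ℚᵘ.- mkℚᵘ z 0 ≈⟨ *≡* cross ⟩
  mkℚᵘ m 0 ℚᵘ.* mkℚᵘ t k             ≈⟨ ℚᵘ.*-cong (toℚᵘ-/ m 0) (toℚᵘ-/ t k) ⟨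
  toℚᵘ (m / 1) ℚᵘ.* toℚᵘ (t / suc k) ≈⟨ ℚ.toℚᵘ-homo-* (m / 1) (t / suc k) ⟨
  toℚᵘ ((m / 1) * (t / suc k))       ∎)
  where
  open import Relation.Binary.Reasoning.Setoid ℚᵘ.≃-setoid
  x = (a / suc k) * (c / 1)
  cross : (a ℤ.* c ℤ.* + 1 ℤ.+ ℤ.- z ℤ.* + (suc (k ℕ.* 1))) ℤ.* + suc (k ℕ.+ 0) ≡
          (m ℤ.* t) ℤ.* + suc (k ℕ.* 1 ℕ.* 1)
  cross rewrite ℕ.*-identityʳ (k ℕ.* 1) | ℕ.*-identityʳ k | ℕ.+-identityʳ k =
    cong (ℤ._* + suc k) (trans (lemma a c z (+ suc k)) (trans eq (ℤ.*-comm t m)))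
    where
    lemma : ∀ a c z k → a ℤ.* c ℤ.* + 1 ℤ.+ ℤ.- z ℤ.* k ≡ a ℤ.* c ℤ.- k ℤ.* z
    lemma = solve-∀

/-mod : ∀ a c z k .{{_ : NonZero k}} → Coprime k p → + k ℤ.* z ≋ a ℤ.* c mod + p →
        (a / k) * (c / 1) ≡ z / 1 [mod p ]
/-mod {p} a c z k k⊥p (∣⇒≋ (divides t eq)) =
  (ℤ.- t) / k , DenominatorPrimeTo-/ (ℤ.- t) k k⊥p , cross-multiply a c z (+ p) (ℤ.- t) k
    (trans (lemma (a ℤ.* c) (+ k ℤ.* z)) (trans (cong ℤ.-_ eq) (ℤ.neg-distribˡ-* t (+ p))))
  where
  lemma : ∀ x y → x ℤ.- y ≡ ℤ.- (y ℤ.- x)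
  lemma = solve-∀

∣⇒/1≡0 : ∀ {z} → + p ℤ.∣ z → z / 1 ≡ 0ℚ [mod p ]
∣⇒/1≡0 {p} {z} (divides q eq) = q / 1 , DenominatorPrimeTo-/ q 1 (Coprime.1-coprimeTo p) , (begin
  z / 1 - 0ℚ                     ≡⟨ cong (_- 0ℚ) (ℚ.*-identityʳ (z / 1)) ⟨
  (z / 1) * (+ 1 / 1) - + 0 / 1  ≡⟨ cross-multiply z (+ 1) (+ 0) (+ p) q 1 (trans (lemma z) eq) ⟩
  (+ p / 1) * (q / 1)            ∎)
  where
  open ≡-Reasoning
  lemma : ∀ z → z ℤ.* + 1 ℤ.- + 1 ℤ.* + 0 ≡ z
  lemma = solve-∀

sum-mod : ∀ n (f : ℕ → ℚ) (z : ℕ → ℤ) → (∀ k → k < n → f k ≡ z k / 1 [mod p ]) →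
          sum +-0-rawMonoid {n} (f ∘ toℕ) ≡ ∑ n z / 1 [mod p ]
sum-mod {p} zero    f z h = mod-refl 0ℚ
sum-mod {p} (suc n) f z h = subst (total ≡_[mod p ]) (sym (/1-homo-+ (z 0) (∑ n (z ∘ suc))))
  (mod-+ (f 0) (z 0 / 1) rest (∑ n (z ∘ suc) / 1) (h 0 (s≤s z≤n))
    (sum-mod n (f ∘ suc) (z ∘ suc) λ k k<n → h (suc k) (s≤s k<n)))
  where
  total rest : ℚ
  total = sum +-0-rawMonoid {suc n} (f ∘ toℕ)
  rest  = sum +-0-rawMonoid {n} (f ∘ suc ∘ toℕ)

summand : (k : ℕ) → .{{NonZero k}} → ℚ
summand k = (+ (2 ^ k) / k) * (+ ((3 ℕ* k) C k) / 1)

odd-case : ∀ p → Prime p → ¬ 2 ℕ.∣ p → ∑[1to p ∸ 1 ] summand ≡ 0ℚ [mod p ]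
odd-case p p-prime 2∤p =
  mod-trans (∑[1to p ∸ 1 ] summand) (∑ (p ∸ 1) (residue p-prime) / 1) 0ℚ
    (sum-mod (p ∸ 1) (λ k → summand (suc k)) (residue p-prime) termwise)
    (∣⇒/1≡0 (p∣∑residue p-prime 2∤p))
  where
  termwise : ∀ k → k < p ∸ 1 → summand (suc k) ≡ residue p-prime k / 1 [mod p ]
  termwise k k<p-1 =
    /-mod (+ (2 ^ suc k)) (+ ((3 ℕ* suc k) C suc k)) (residue p-prime k) (suc k)
      (Coprime.sym (prime⇒coprime p-prime 1+k<p)) ([1+k]residue p-prime k 1+k<p)
    where 1+k<p = ℕ.pred-cancel-< {suc k} k<p-1

even-case : ∀ p → Prime p → 2 ℕ.∣ p → ∑[1to p ∸ 1 ] summand ≡ 0ℚ [mod p ]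
even-case p p-prime 2∣p with prime⇒irreducible p-prime 2∣p
... | inj₂ refl = + 3 / 1 , DenominatorPrimeTo-/ (+ 3) 1 (Coprime.1-coprimeTo 2) , refl

theorem1p3 : (p : ℕ) → Prime p →
    ∑[1to p ∸ 1 ] (λ k → (+ (2 ^ k) / k) * (+ ((3 ℕ* k) C k) / 1)) ≡ 0ℚ [mod p ]
theorem1p3 p p-prime = [ even-case p p-prime , odd-case p p-prime ]′ (toSum (2 ℕ.∣? p))
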